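{- Let $G$ be a graph with at least one edge. The following statements are equivalent: (i) $\alpha_{\rm es}(G)=0$; (ii) every vertex $x\in V(G)$ has a neighbor $y\in N(x)$ such that $N[y]\subseteq N[x]$; (iii) every vertex of $G$ is a universal vertex, or a twin, or a support of a twin.
   Context: All graphs are finite and simple. $N(v)$ and $N[v]=N(v)\cup\{v\}$ are the open and closed neighborhoods of $v$; for $B\subseteq V(G)$, $N[B]=\bigcup_{b\in B}N[b]$ and $N(B)=N[B]- B$. A set $B\subseteq V(G)$ is an externally supported independence set (ESI-set) if $B$ is independent and every $v\in N(B)$ has a neighbor in $V(G)- N[B]$ (the empty set is an ESI-set); $\alpha_{\rm es}(G)$ is the maximum cardinality of an ESI-set of $G$. A vertex is universal if its degree is $|V(G)|-1$. Distinct vertices $u,v$ are twins if $N[u]=N[v]$; a vertex $u$ is called a twin if there is some $v\neq u$ such that $u$ and $v$ are twins. A vertex $w$ is a support of a twin if there is a twin $u$ with $N[u]\subsetneq N[w]$. -}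

module Defs where

open import Data.Bool.Base using (true; false)
open import Data.Fin.Base using (Fin)
open import Data.Fin.Properties using (all?; any?)
open import Data.Fin.Subset
open import Data.Fin.Subset.Properties using (_∈?_; ∉⊥; ∣⊥∣≡0; p─q⊆p)
open import Data.List.Base using (List; []; _∷_; _++_; map; filter; allFin)
open import Data.List.Extrema.Nat using (max; argmax-sel; xs≤max)
open import Data.List.Membership.Propositional using () renaming (_∈_ to _∈ᴸ_)
open import Data.List.Membership.Propositional.Properties
  using (∈-map⁺; ∈-map⁻; ∈-++⁺ˡ; ∈-++⁺ʳ; ∈-filter⁺; ∈-filter⁻)
open import Data.List.Properties using (filter-none)
open import Data.List.Relation.Unary.All using (lookup; universal)
open import Data.List.Relation.Unary.Any using (here)
open import Data.Nat.Base using (ℕ; suc; _∸_; _≤_)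
open import Data.Product.Base using (_×_; _,_; ∃₂; ∃-syntax; proj₂)
open import Data.Sum.Base using (inj₁; inj₂)
import Data.Vec.Base as Vec
open import Function.Base using (id; _∘_)
open import Level using (0ℓ)
open import Relation.Binary.Core using (Rel)
open import Relation.Binary.Definitions using (Symmetric; Irreflexive; Decidable)
open import Relation.Binary.PropositionalEquality using (_≡_; _≢_; refl; sym; trans; cong; subst)
open import Relation.Nullary using (Dec; ¬_; ¬?; ⌊_⌋; _×-dec_; _→-dec_)
open import Relation.Nullary.Negation using (contradiction)

private
  variable
    n : ℕ

subsets : ∀ n → List (Subset n)
subsets 0       = Vec.[] ∷ []
subsets (suc n) = map (inside Vec.∷_) (subsets n) ++ map (outside Vec.∷_) (subsets n)

∈-subsets : (B : Subset n) → B ∈ᴸ subsets n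
∈-subsets Vec.[]            = here refl
∈-subsets (true  Vec.∷ B) = ∈-++⁺ˡ (∈-map⁺ (inside Vec.∷_) (∈-subsets B))
∈-subsets (false Vec.∷ B) = ∈-++⁺ʳ _ (∈-map⁺ (outside Vec.∷_) (∈-subsets B))

record SimpleGraph (n : ℕ) : Set₁ where
  infix 4 _~_ _~?_
  field
    _~_      : Rel (Fin n) 0ℓ
    _~?_     : Decidable _~_
    ~-sym    : Symmetric _~_
    ~-irrefl : Irreflexive _≡_ _~_

  HasEdge : Set
  HasEdge = ∃₂ _~_

  N : Fin n → Subset n
  N v = Vec.tabulate (λ w → ⌊ v ~? w ⌋)

  N[_] : Fin n → Subset n
  N[ v ] = N v ∪ ⁅ v ⁆

  Nˢ[_] : Subset n → Subset n
  Nˢ[ B ] = ⋃ (map N[_] (filter (_∈? B) (allFin n)))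

  Nˢ : Subset n → Subset n
  Nˢ B = Nˢ[ B ] ─ B

  Independent : Subset n → Set
  Independent B = ∀ u v → u ∈ B → v ∈ B → ¬ (u ~ v)

  ExternallySupported : Subset n → Set
  ExternallySupported B = ∀ v → v ∈ Nˢ B → ∃[ w ] (w ∈ N v × w ∉ Nˢ[ B ])

  ESI : Subset n → Set
  ESI B = Independent B × ExternallySupported B

  ESI? : ∀ B → Dec (ESI B)
  ESI? B =
    all? (λ u → all? λ v → (u ∈? B) →-dec ((v ∈? B) →-dec ¬? (u ~? v)))
    ×-dec
    all? (λ v → (v ∈? Nˢ B) →-dec any? λ w → (w ∈? N v) ×-dec ¬? (w ∈? Nˢ[ B ]))

  -- The default value 0 of the maximum is the cardinality of the empty
  -- ESI-set; see α-es-attained and α-es-upper.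
  α-es : ℕ
  α-es = max 0 (map ∣_∣ (filter ESI? (subsets n)))

  Universal : Fin n → Set
  Universal v = ∣ N v ∣ ≡ n ∸ 1

  Twins : Fin n → Fin n → Set
  Twins u v = u ≢ v × N[ u ] ≡ N[ v ]

  Twin : Fin n → Set
  Twin u = ∃[ v ] Twins u v

  SupportOfTwin : Fin n → Set
  SupportOfTwin w = ∃[ u ] (Twin u × N[ u ] ⊂ N[ w ])

  Nˢ[⊥]≡⊥ : Nˢ[ ⊥ ] ≡ ⊥
  Nˢ[⊥]≡⊥ = cong (⋃ ∘ map N[_]) (filter-none (_∈? ⊥) (universal (λ _ → ∉⊥) (allFin n)))

  ESI-⊥ : ESI ⊥
  ESI-⊥ = (λ u v u∈⊥ v∈⊥ _ → ∉⊥ u∈⊥)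
        , (λ v v∈N⊥ → contradiction (subst (v ∈_) Nˢ[⊥]≡⊥ (p─q⊆p Nˢ[ ⊥ ] ⊥ v∈N⊥)) ∉⊥)

  α-es-attained : ∃[ B ] (ESI B × ∣ B ∣ ≡ α-es)
  α-es-attained with argmax-sel id 0 (map ∣_∣ (filter ESI? (subsets n)))
  ... | inj₁ max≡0 = ⊥ , ESI-⊥ , trans (∣⊥∣≡0 n) (sym max≡0)
  ... | inj₂ max∈  with ∈-map⁻ ∣_∣ max∈
  ...   | B , B∈ , max≡∣B∣ = B , proj₂ (∈-filter⁻ ESI? {xs = subsets n} B∈) , sym max≡∣B∣

  α-es-upper : ∀ B → ESI B → ∣ B ∣ ≤ α-es
  α-es-upper B esi =
    lookup (xs≤max 0 _) (∈-map⁺ ∣_∣ (∈-filter⁺ ESI? (∈-subsets B) esi))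

{-# OPTIONS --safe #-}
-- The singleton {x} fails to be an ESI-set exactly when some neighbour y of x
-- has no neighbour outside N[x], i.e. N[y] ⊆ N[x]; the same y shows that no
-- ESI-set contains x.  If N[y] = N[x], then x is a twin; if the inclusion is
-- strict, descend from x to y until a twin is reached, which x then supports.
module Submission where

open import Defs
open import Data.Bool.Properties using (T-≡)
open import Data.Fin.Base using (Fin)
open import Data.Fin.Properties using (_≟_; any?; ¬∀⟶∃¬)
open import Data.Fin.Subset using (Subset; inside; outside; ⁅_⁆; ⋃; _─_; ∣_∣; _∈_; _∉_; _⊆_; _⊈_; _⊂_)
open import Data.Fin.Subset.Induction using (Acc; acc; ⊂-wellFounded)
open import Data.Fin.Subset.Properties
  using (_∈?_; _⊆?_; ∈⊤; ∉⊥; x∈⁅x⁆; x∈⁅y⁆⇒x≡y; ∣⁅x⁆∣≡1; ∣⊥∣≡0; Empty-unique; nonempty?;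
         ⊆-antisym; ⊂-trans; ∣p∣≤n; ∣p∣≡n⇒p≡⊤; p⊂q⇒∣p∣<∣q∣; x∈p∪q⁻; x∈p∪q⁺; p⊆p∪q; q⊆p∪q;
         x∈p∧x∉q⇒x∈p─q; p─q⊆p)
open import Data.List.Base using ([]; _∷_; allFin)
open import Data.List.Membership.Propositional using (lose; find)
open import Data.List.Membership.Propositional.Properties using (∈-allFin; ∈-filter⁺; ∈-filter⁻)
open import Data.List.Relation.Unary.Any using (Any; here; there)
open import Data.List.Relation.Unary.Any.Properties using (map⁺; map⁻)
open import Data.Nat.Base using (ℕ; _≤_; _<_)
open import Data.Nat.Properties using (≤-trans; ≤-antisym; m≤n+m∸n; n≮0)
open import Data.Product.Base using (_×_; _,_; ∃-syntax; proj₁; proj₂)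
open import Data.Sum.Base using (_⊎_; inj₁; inj₂; [_,_]′)
import Data.Vec.Base as Vec
open import Data.Vec.Properties using ([]=⇒lookup; lookup∘tabulate)
open import Function.Base using (_∘_)
open import Function.Bundles using (_⇔_; mk⇔; Equivalence)
open import Relation.Binary.PropositionalEquality using (_≡_; _≢_; refl; sym; trans; cong; subst)
open import Relation.Nullary using (¬_; yes; no; isYes; _×-dec_; _→-dec_)
open import Relation.Nullary.Decidable using (toWitness; decidable-stable)
open import Relation.Nullary.Negation using (contradiction)

private
  variable
    m : ℕ
    p q : Subset m

x∈p─q⇒x∉q : ∀ {x} (p q : Subset m) → x ∈ p ─ q → x ∉ q
x∈p─q⇒x∉q (_ Vec.∷ p) (outside Vec.∷ q) (Vec.there x∈p─q) (Vec.there x∈q) = x∈p─q⇒x∉q p q x∈p─q x∈q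
x∈p─q⇒x∉q (_ Vec.∷ p) (inside  Vec.∷ q) (Vec.there x∈p─q) (Vec.there x∈q) = x∈p─q⇒x∉q p q x∈p─q x∈q

x∈⋃⁺ : ∀ {x : Fin m} {ps} → Any (x ∈_) ps → x ∈ ⋃ ps
x∈⋃⁺ (here x∈p)   = x∈p∪q⁺ (inj₁ x∈p)
x∈⋃⁺ (there x∈ps) = x∈p∪q⁺ (inj₂ (x∈⋃⁺ x∈ps))

x∈⋃⁻ : ∀ {x : Fin m} ps → x ∈ ⋃ ps → Any (x ∈_) ps
x∈⋃⁻ []       x∈⊥ = contradiction x∈⊥ ∉⊥
x∈⋃⁻ (p ∷ ps) x∈ = [ here , there ∘ x∈⋃⁻ ps ]′ (x∈p∪q⁻ p (⋃ ps) x∈)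

-- Decidable membership over finitely many points turns the mere failure of an inclusion into a
-- witness. Both external support and the strictness in `_⊂_` ask for such a point.
⊈⇒∃ : p ⊈ q → ∃[ x ] (x ∈ p × x ∉ q)
⊈⇒∃ {p = p} {q} p⊈q
  with x , ¬x∈p⇒x∈q ← ¬∀⟶∃¬ _ _ (λ x → (x ∈? p) →-dec (x ∈? q)) (λ f → p⊈q (f _))
  = x , decidable-stable (x ∈? p) (λ x∉p → ¬x∈p⇒x∈q (λ x∈p → contradiction x∈p x∉p))
      , λ x∈q → ¬x∈p⇒x∈q (λ _ → x∈q)

module _ {n : ℕ} (G : SimpleGraph n) where
  open SimpleGraph G

  ∈N⇒~ : ∀ {v w} → w ∈ N v → v ~ w
  ∈N⇒~ {v} {w} w∈Nv = toWitness {a? = v ~? w} (Equivalence.from T-≡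
    (trans (sym (lookup∘tabulate (λ u → isYes (v ~? u)) w)) ([]=⇒lookup w∈Nv)))

  x∉Nx : ∀ x → x ∉ N x
  x∉Nx x x∈Nx = ~-irrefl refl (∈N⇒~ x∈Nx)

  x∈N[x] : ∀ x → x ∈ N[ x ]
  x∈N[x] x = q⊆p∪q (N x) ⁅ x ⁆ (x∈⁅x⁆ x)

  N⊆N[] : ∀ x → N x ⊆ N[ x ]
  N⊆N[] x = p⊆p∪q ⁅ x ⁆

  ∈N[]∧≢⇒∈N : ∀ {x y} → y ∈ N[ x ] → y ≢ x → y ∈ N x
  ∈N[]∧≢⇒∈N {x} y∈ y≢x with x∈p∪q⁻ (N x) ⁅ x ⁆ y∈
  ... | inj₁ y∈Nx = y∈Nx
  ... | inj₂ y∈⁅x⁆ = contradiction (x∈⁅y⁆⇒x≡y x y∈⁅x⁆) y≢x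

  ∈Nˢ[]⁺ : ∀ {B b v} → b ∈ B → v ∈ N[ b ] → v ∈ Nˢ[ B ]
  ∈Nˢ[]⁺ {B} {b} b∈B v∈N[b] =
    x∈⋃⁺ (map⁺ (lose (∈-filter⁺ (_∈? B) (∈-allFin b) b∈B) v∈N[b]))

  ∈Nˢ[]⁻ : ∀ {B v} → v ∈ Nˢ[ B ] → ∃[ b ] (b ∈ B × v ∈ N[ b ])
  ∈Nˢ[]⁻ {B} v∈ with b , b∈ , v∈N[b] ← find (map⁻ (x∈⋃⁻ _ v∈)) =
    b , proj₂ (∈-filter⁻ (_∈? B) {xs = allFin n} b∈) , v∈N[b]

  Nˢ[⁅x⁆]⊆N[x] : ∀ x → Nˢ[ ⁅ x ⁆ ] ⊆ N[ x ]
  Nˢ[⁅x⁆]⊆N[x] x v∈ with b , b∈⁅x⁆ , v∈N[b] ← ∈Nˢ[]⁻ v∈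
    with refl ← x∈⁅y⁆⇒x≡y x b∈⁅x⁆ = v∈N[b]

  -- Condition (ii) at the single vertex `x`.
  DominatesNeighbour : Fin n → Set
  DominatesNeighbour x = ∃[ y ] (y ∈ N x × N[ y ] ⊆ N[ x ])

  -- Each `v` to be supported is a neighbour of `x`, so some `w` in `N[ v ]` escapes `N[ x ]`. As
  -- `v` itself does not escape, `w` differs from `v` and is a genuine neighbour of it.
  ¬DominatesNeighbour⇒ESI-⁅x⁆ : ∀ x → ¬ DominatesNeighbour x → ESI ⁅ x ⁆
  ¬DominatesNeighbour⇒ESI-⁅x⁆ x ¬dom = independent , supported
    where
    independent : Independent ⁅ x ⁆
    independent u v u∈ v∈ = ~-irrefl (trans (x∈⁅y⁆⇒x≡y x u∈) (sym (x∈⁅y⁆⇒x≡y x v∈)))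

    supported : ExternallySupported ⁅ x ⁆
    supported v v∈Nˢ = w , ∈N[]∧≢⇒∈N w∈N[v] w≢v , w∉N[x] ∘ Nˢ[⁅x⁆]⊆N[x] x
      where
      v∈N[x] = Nˢ[⁅x⁆]⊆N[x] x (p─q⊆p Nˢ[ ⁅ x ⁆ ] ⁅ x ⁆ v∈Nˢ)
      v≢x : v ≢ x
      v≢x refl = x∈p─q⇒x∉q Nˢ[ ⁅ x ⁆ ] ⁅ x ⁆ v∈Nˢ (x∈⁅x⁆ x)
      outer = ⊈⇒∃ {p = N[ v ]} {q = N[ x ]} (λ sub → ¬dom (v , ∈N[]∧≢⇒∈N v∈N[x] v≢x , sub))
      w = proj₁ outer
      w∈N[v] = proj₁ (proj₂ outer)
      w∉N[x] = proj₂ (proj₂ outer)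
      w≢v : w ≢ v
      w≢v w≡v = w∉N[x] (subst (_∈ N[ x ]) (sym w≡v) v∈N[x])

  α-es≡0⇒DominatesNeighbour : α-es ≡ 0 → ∀ x → DominatesNeighbour x
  α-es≡0⇒DominatesNeighbour α≡0 x =
    -- The search for `y` is finite and decidable, so refuting its failure suffices: failure would
    -- give an ESI-set of size 1, against `α≡0`.
    decidable-stable (any? λ y → (y ∈? N x) ×-dec (N[ y ] ⊆? N[ x ])) λ ¬dom →
      n≮0 (subst (1 ≤_) α≡0
        (subst (_≤ α-es) (∣⁅x⁆∣≡1 x)
          (α-es-upper ⁅ x ⁆ (¬DominatesNeighbour⇒ESI-⁅x⁆ x ¬dom))))

  -- Independence keeps the dominated neighbour `y` out of `B`, so `y` needs a neighbour outside
  -- `Nˢ[ B ]`; but all of `N[ y ]` lies in `N[ x ]`, hence in `Nˢ[ B ]`.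
  ∈ESI⇒¬DominatesNeighbour : ∀ {B x} → ESI B → x ∈ B → ¬ DominatesNeighbour x
  ∈ESI⇒¬DominatesNeighbour {B} {x} (independent , supported) x∈B (y , y∈Nx , N[y]⊆N[x])
    with w , w∈Ny , w∉Nˢ[B] ← supported y (x∈p∧x∉q⇒x∈p─q (∈Nˢ[]⁺ x∈B (N⊆N[] x y∈Nx))
                                            (λ y∈B → independent x y x∈B y∈B (∈N⇒~ y∈Nx)))
    = w∉Nˢ[B] (∈Nˢ[]⁺ x∈B (N[y]⊆N[x] (N⊆N[] y w∈Ny)))

  DominatesNeighbour⇒α-es≡0 : (∀ x → DominatesNeighbour x) → α-es ≡ 0
  DominatesNeighbour⇒α-es≡0 dom with B , esi , ∣B∣≡α ← α-es-attained | nonempty? B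
  ... | yes (x , x∈B) = contradiction (dom x) (∈ESI⇒¬DominatesNeighbour esi x∈B)
  ... | no  empty     = trans (sym ∣B∣≡α) (trans (cong ∣_∣ (Empty-unique empty)) (∣⊥∣≡0 n))

  DominatesNeighbour⇒Twin⊎SupportOfTwin :
    (∀ x → DominatesNeighbour x) → ∀ x → Twin x ⊎ SupportOfTwin x
  DominatesNeighbour⇒Twin⊎SupportOfTwin dom x = go x (⊂-wellFounded N[ x ])
    where
    -- The descent terminates because closed neighbourhoods shrink strictly along it.
    go : ∀ x → Acc _⊂_ N[ x ] → Twin x ⊎ SupportOfTwin x
    go x (acc rec) with y , y∈Nx , N[y]⊆N[x] ← dom x | N[ x ] ⊆? N[ y ]
    ... | yes N[x]⊆N[y] =
      inj₁ (y , (λ { refl → x∉Nx x y∈Nx }) , ⊆-antisym N[x]⊆N[y] N[y]⊆N[x])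
    ... | no  N[x]⊈N[y] = inj₂
      -- Either `y` is itself the supported twin, or the twin that `y` supports is passed up to `x`
      -- by transitivity of strict inclusion.
      ([ (λ twin-y → y , twin-y , N[y]⊂N[x])
       , (λ (u , twin-u , N[u]⊂N[y]) → u , twin-u , ⊂-trans N[u]⊂N[y] N[y]⊂N[x])
       ]′ (go y (rec N[y]⊂N[x])))
      where
      N[y]⊂N[x] : N[ y ] ⊂ N[ x ]
      N[y]⊂N[x] = N[y]⊆N[x] , ⊈⇒∃ N[x]⊈N[y]

  -- By counting: adding `x` to its `n ∸ 1` neighbours gives at least `n` vertices, so `N[ x ]` is
  -- everything.
  Universal⇒∈N[] : ∀ {x} → Universal x → ∀ y → y ∈ N[ x ]
  Universal⇒∈N[] {x} deg≡n-1 y = subst (y ∈_) (sym (∣p∣≡n⇒p≡⊤ (≤-antisym (∣p∣≤n N[ x ]) n≤∣N[x]∣))) ∈⊤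
    where
    N⊂N[] : N x ⊂ N[ x ]
    N⊂N[] = N⊆N[] x , x , x∈N[x] x , x∉Nx x
    -- The strict inequality `n ∸ 1 < ∣ N[ x ] ∣` unfolds to a bound on `1 + (n ∸ 1)`, which is at
    -- least `n` even with truncated subtraction.
    n≤∣N[x]∣ = ≤-trans (m≤n+m∸n n 1) (subst (_< ∣ N[ x ] ∣) deg≡n-1 (p⊂q⇒∣p∣<∣q∣ N⊂N[]))

  -- Rules out the one-vertex graph, whose vertex is universal yet has no neighbour to dominate.
  HasEdge⇒∃≢ : HasEdge → ∀ x → ∃[ y ] y ≢ x
  HasEdge⇒∃≢ (u , v , u~v) x with u ≟ x
  ... | yes refl = v , λ v≡u → ~-irrefl (sym v≡u) u~v
  ... | no  u≢x  = u , u≢x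

  Universal⇒DominatesNeighbour : HasEdge → ∀ {x} → Universal x → DominatesNeighbour x
  Universal⇒DominatesNeighbour edge {x} univ with y , y≢x ← HasEdge⇒∃≢ edge x =
    y , ∈N[]∧≢⇒∈N (Universal⇒∈N[] univ y) y≢x , λ _ → Universal⇒∈N[] univ _

  Twin⇒DominatesNeighbour : ∀ {x} → Twin x → DominatesNeighbour x
  Twin⇒DominatesNeighbour {x} (y , x≢y , N[x]≡N[y]) =
    y , ∈N[]∧≢⇒∈N (N[y]⊆N[x] (x∈N[x] y)) (x≢y ∘ sym) , N[y]⊆N[x]
    where
    N[y]⊆N[x] : N[ y ] ⊆ N[ x ]
    N[y]⊆N[x] {z} = subst (z ∈_) (sym N[x]≡N[y])

  SupportOfTwin⇒DominatesNeighbour : ∀ {x} → SupportOfTwin x → DominatesNeighbour x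
  SupportOfTwin⇒DominatesNeighbour (u , _ , N[u]⊆N[x] , z , z∈N[x] , z∉N[u]) =
    -- The point `z` witnessing strictness separates the two closed neighbourhoods, so `u` is not
    -- `x`.
    u , ∈N[]∧≢⇒∈N (N[u]⊆N[x] (x∈N[x] u)) (λ { refl → z∉N[u] z∈N[x] }) , N[u]⊆N[x]

theorem10 : ∀ {n : ℕ} (G : SimpleGraph n) → let open SimpleGraph G in
    HasEdge →
    ((α-es ≡ 0) ⇔ (∀ x → ∃[ y ] (y ∈ N x × N[ y ] ⊆ N[ x ])))
    × ((∀ x → ∃[ y ] (y ∈ N x × N[ y ] ⊆ N[ x ])) ⇔
    (∀ x → Universal x ⊎ Twin x ⊎ SupportOfTwin x))
theorem10 G edge =
    mk⇔ (α-es≡0⇒DominatesNeighbour G) (DominatesNeighbour⇒α-es≡0 G)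
  , mk⇔ (λ dom x → inj₂ (DominatesNeighbour⇒Twin⊎SupportOfTwin G dom x))
        (λ classified x →
          [ Universal⇒DominatesNeighbour G edge
          , [ Twin⇒DominatesNeighbour G , SupportOfTwin⇒DominatesNeighbour G ]′
          ]′ (classified x))
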